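{- Fix $k\in\mathbb{N}$ and let $\mathcal{D}_k$ be the class of $k$-degenerate graphs. Then for every fixed forest $T$, $$C(T,\mathcal{D}_k,n) \in \Theta(n^{\alpha_k(T)}) \quad (n\to\infty).$$
   Context: All graphs are finite, simple and undirected. A graph is $k$-degenerate if every subgraph has minimum degree at most $k$. For graphs $H,G$, $C(H,G)$ denotes the number of subgraphs of $G$ isomorphic to $H$ ("copies" of $H$). For a graph class $\mathcal{G}$, $C(H,\mathcal{G},n):=\max\{C(H,G): G\in\mathcal{G},\ |V(G)|=n\}$. For a graph $G$ and $s\in\mathbb{N}_0$, $\alpha_s(G)$ is the maximum size of a stable (independent) set in the subgraph of $G$ induced by the vertices of degree at most $s$ in $G$. The notation $\Theta(n^{a})$ means bounded above and below by positive constant multiples of $n^a$ (constants depending on $T$ and $k$) for all sufficiently large $n$. -}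

module Defs where

open import Data.Bool using (Bool; true; false; _∧_; _∨_; not; _xor_; T; if_then_else_)
open import Data.Nat using (ℕ; zero; suc; _+_; _*_; _^_; _≤_; _≤ᵇ_; _≡ᵇ_; _⊔_)
open import Data.Fin using (Fin; toℕ; inject₁; fromℕ) renaming (zero to fzero; suc to fsuc)
open import Data.List using (List; []; _∷_; map; length; foldr; concatMap; allFin)
open import Data.Bool.ListAction using (all; any)
open import Data.Vec using (Vec; lookup) renaming ([] to []ᵥ; _∷_ to _∷ᵥ_)
open import Data.Product using (Σ; ∃; _×_; _,_)
open import Relation.Binary.PropositionalEquality using (_≡_)
open import Relation.Nullary using (¬_)
open import Function.Definitions using (Injective)

record Graph (n : ℕ) : Set where
  field
    adj    : Fin n → Fin n → Bool
    sym    : ∀ i j → adj i j ≡ adj j i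
    irrefl : ∀ i → adj i i ≡ false
open Graph public

eqB : Bool → Bool → Bool
eqB a b = not (a xor b)

_⇒ᵇ_ : Bool → Bool → Bool
a ⇒ᵇ b = not a ∨ b

_≟ᶠ_ : ∀ {n} → Fin n → Fin n → Bool
i ≟ᶠ j = toℕ i ≡ᵇ toℕ j

allV : ∀ n → (Fin n → Bool) → Bool
allV n p = all p (allFin n)

anyV : ∀ n → (Fin n → Bool) → Bool
anyV n p = any p (allFin n)

countL : ∀ {A : Set} → (A → Bool) → List A → ℕ
countL p = foldr (λ x acc → if p x then suc acc else acc) 0

countF : ∀ {n} → (Fin n → Bool) → ℕ
countF {n} p = countL p (allFin n)

degree : ∀ {n} → Graph n → Fin n → ℕ
degree G v = countF (adj G v)

vecs : ∀ {A : Set} → List A → (m : ℕ) → List (Vec A m)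
vecs xs zero    = []ᵥ ∷ []
vecs xs (suc m) = concatMap (λ x → map (x ∷ᵥ_) (vecs xs m)) xs

bools : List Bool
bools = true ∷ false ∷ []

-- A subgraph of G: vertex set S (characteristic vector) and edge set E
-- (symmetric adjacency matrix), every edge of E being an edge of G with both
-- ends in S.  Each subgraph has exactly one such representation.
isSubgraph : ∀ {n} → Graph n → Vec Bool n → Vec (Vec Bool n) n → Bool
isSubgraph {n} G S E =
  allV n λ i → allV n λ j →
    eqB (lookup (lookup E i) j) (lookup (lookup E j) i)
    ∧ (lookup (lookup E i) j ⇒ᵇ (adj G i j ∧ lookup S i ∧ lookup S j))

isIsoVia : ∀ {m n} → Graph m → Vec Bool n → Vec (Vec Bool n) n → Vec (Fin n) m → Bool
isIsoVia {m} {n} H S E σ =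
  (allV m λ i → allV m λ j → (lookup σ i ≟ᶠ lookup σ j) ⇒ᵇ (i ≟ᶠ j))
  ∧ (allV n λ v → eqB (lookup S v) (anyV m λ i → lookup σ i ≟ᶠ v))
  ∧ (allV m λ i → allV m λ j →
       eqB (lookup (lookup E (lookup σ i)) (lookup σ j)) (adj H i j))

isCopy : ∀ {m n} → Graph m → Graph n → Vec Bool n × Vec (Vec Bool n) n → Bool
isCopy {m} {n} H G (S , E) =
  isSubgraph G S E ∧ any (isIsoVia H S E) (vecs (allFin n) m)

copies : ∀ {m n} → Graph m → Graph n → ℕ
copies {m} {n} H G =
  countL (isCopy H G)
    (concatMap (λ S → map (λ E → (S , E)) (vecs (vecs bools n) n)) (vecs bools n))

Degenerate : ℕ → ∀ {n} → Graph n → Set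
Degenerate k {n} G =
  (S : Fin n → Bool) (E : Fin n → Fin n → Bool) →
  (∀ i j → E i j ≡ E j i) →
  (∀ i j → T (E i j) → T (adj G i j ∧ S i ∧ S j)) →
  (∃ λ i → T (S i)) →
  ∃ λ v → T (S v) × countF (E v) ≤ k

Forest : ∀ {m} → Graph m → Set
Forest {m} H =
  (l : ℕ) (c : Fin (suc (suc (suc l))) → Fin m) → Injective _≡_ _≡_ c →
  ¬ ((∀ (i : Fin (suc (suc l))) → T (adj H (c (inject₁ i)) (c (fsuc i))))
     × T (adj H (c (fromℕ (suc (suc l)))) (c fzero)))

size : ∀ {m} → Vec Bool m → ℕ
size {m} S = countF (lookup S)

isLowStable : ∀ {m} → Graph m → ℕ → Vec Bool m → Bool
isLowStable {m} H s S =
  (allV m λ i → lookup S i ⇒ᵇ (degree H i ≤ᵇ s))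
  ∧ (allV m λ i → allV m λ j → (lookup S i ∧ lookup S j) ⇒ᵇ not (adj H i j))

alpha : ∀ {m} → Graph m → ℕ → ℕ
alpha {m} H s =
  foldr _⊔_ 0 (map (λ S → if isLowStable H s S then size S else 0) (vecs bools m))

{-# OPTIONS --safe #-}
module Submission where

-- Upper bound: repeatedly deleting a vertex of degree at most k ranks the vertices
-- of G so that each has at most k neighbours of larger rank.  In a copy of F, the
-- vertices whose neighbours all have larger rank form a stable set of vertices of
-- degree at most k, hence number at most α_k(F); every other vertex is one of at
-- most k later neighbours of the image of one of its neighbours.  So the images of
-- the former determine the copy up to boundedly many choices.
-- Lower bound: take t copies of each vertex of a maximum such stable set X.  The
-- copies have degree at most k, and the rest is a forest, so the blow-up is
-- k-degenerate; it contains t^|X| copies of F.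

open import Defs
open import Data.Bool using (Bool; true; false; _∧_; not; T; T?; if_then_else_)
open import Data.Bool.Properties using (T-∧; T-≡; ∧-comm; ∧-zeroʳ)
open import Data.Empty using (⊥; ⊥-elim)
open import Data.Fin as Fin using (Fin; toℕ; inject₁; fromℕ) renaming (zero to fzero; suc to fsuc)
open import Data.Fin.Properties as Fin using (toℕ-injective; injective⇒≤; any?)
open import Data.List using (List; []; _∷_; _++_; map; length; foldr; concatMap; allFin; filter;
  tabulate; cartesianProduct; cartesianProductWith)
import Data.List as List
open import Data.List.Properties using (length-map; length-++; length-tabulate; length-filter)
open import Data.List.Membership.Propositional using (_∈_; lose)
open import Data.List.Membership.Propositional.Properties
open import Data.List.Relation.Unary.All as All using ([]; _∷_)
import Data.List.Relation.Unary.All.Properties as All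
open import Data.List.Relation.Unary.Any as Any using (here; there)
import Data.List.Relation.Unary.Any.Properties as Any
open import Data.List.Relation.Unary.AllPairs using ([]; _∷_)
open import Data.List.Relation.Unary.Unique.Propositional using (Unique)
import Data.List.Relation.Unary.Unique.Propositional.Properties as Unique
open import Data.Maybe using (Maybe; just; nothing; maybe)
open import Data.Maybe.Properties using (just-injective)
open import Data.Nat using (ℕ; zero; suc; _+_; _*_; _^_; _≤_; _<_; _⊔_; _≤ᵇ_; _<ᵇ_; z≤n; s≤s)
open import Data.Nat.DivMod using (_/_; _%_; m≡m%n+[m/n]*n; m%n<n; m≥n⇒m/n>0)
open import Data.Nat.Properties
open import Data.Product using (∃; _×_; _,_; proj₁; proj₂)
open import Data.Sum using (_⊎_; inj₁; inj₂)
open import Data.Unit using (tt)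
open import Data.Vec using (Vec; lookup) renaming ([] to []ᵥ; _∷_ to _∷ᵥ_)
import Data.Vec as Vec
import Data.Vec.Properties as Vec
open import Function using (_∘_; id; const; _⇔_; mk⇔; Equivalence)
open import Function.Definitions using (Injective)
open import Relation.Binary.PropositionalEquality using (_≡_; _≢_; refl; trans; cong; cong₂; subst; subst₂; _≗_)
  renaming (sym to ≡-sym)
open import Relation.Nullary using (¬_; Dec; yes; no; contradiction; ¬?; _×-dec_)
open import Relation.Nullary.Decidable using (decidable-stable)
open Equivalence using (to; from)

-- Boolean tests as propositions, and extensionality of vectors.

T-ext : ∀ {a b} → (T a → T b) → (T b → T a) → a ≡ b
T-ext {true}  {true}  f g = refl
T-ext {true}  {false} f g = ⊥-elim (f tt)
T-ext {false} {true}  f g = ⊥-elim (g tt)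
T-ext {false} {false} f g = refl

T-not : ∀ {a} → T (not a) ⇔ (¬ T a)
T-not {true}  = mk⇔ (λ ()) (λ f → f tt)
T-not {false} = mk⇔ (λ _ ()) (λ _ → tt)

T-⇒ : ∀ {a b} → T (a ⇒ᵇ b) ⇔ (T a → T b)
T-⇒ {true}  = mk⇔ const (λ f → f tt)
T-⇒ {false} = mk⇔ (λ _ ()) (λ _ → tt)

T-eqB : ∀ {a b} → T (eqB a b) ⇔ a ≡ b
T-eqB {true}  {true}  = mk⇔ (λ _ → refl) (λ _ → tt)
T-eqB {true}  {false} = mk⇔ (λ ()) (λ ())
T-eqB {false} {true}  = mk⇔ (λ ()) (λ ())
T-eqB {false} {false} = mk⇔ (λ _ → refl) (λ _ → tt)

T-≟ᶠ : ∀ {n} {i j : Fin n} → T (i ≟ᶠ j) ⇔ i ≡ j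
T-≟ᶠ {i = i} {j} =
  mk⇔ (λ t → toℕ-injective (≡ᵇ⇒≡ (toℕ i) (toℕ j) t)) (λ { refl → ≡⇒≡ᵇ (toℕ i) (toℕ i) refl })

T-allV : ∀ {n} {p : Fin n → Bool} → T (allV n p) ⇔ (∀ i → T (p i))
T-allV {n} {p} = mk⇔ (λ t i → All.lookup (All.all⁺ p (allFin n) t) (∈-allFin i))
                     (λ f → All.all⁻ p (All.tabulate {xs = allFin n} (λ {i} _ → f i)))

T-anyV : ∀ {n} {p : Fin n → Bool} → T (anyV n p) ⇔ (∃ λ i → T (p i))
T-anyV {n} {p} = mk⇔ (λ t → Any.satisfied (Any.any⁻ p (allFin n) t))
                     (λ { (i , pi) → Any.any⁺ p (lose (∈-allFin i) pi) })

lookup-ext : ∀ {A : Set} {m} {u v : Vec A m} → lookup u ≗ lookup v → u ≡ v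
lookup-ext {u = []ᵥ}     {[]ᵥ}     e = refl
lookup-ext {u = x ∷ᵥ u} {y ∷ᵥ v} e = cong₂ _∷ᵥ_ (e fzero) (lookup-ext (e ∘ fsuc))

-- Comparing cardinalities through injective relations.

countL≡length-filter : ∀ {A : Set} (p : A → Bool) xs → countL p xs ≡ length (filter (T? ∘ p) xs)
countL≡length-filter p [] = refl
countL≡length-filter p (x ∷ xs) with p x
... | true  = cong suc (countL≡length-filter p xs)
... | false = countL≡length-filter p xs

Unique⇒lookup-injective : ∀ {A : Set} {xs : List A} → Unique xs →
  ∀ i j → List.lookup xs i ≡ List.lookup xs j → i ≡ j
Unique⇒lookup-injective (_ ∷ _)  fzero    fzero    e = refl
Unique⇒lookup-injective (x∉ ∷ _) fzero    (fsuc j) e = contradiction e (All.lookup x∉ (∈-lookup j))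
Unique⇒lookup-injective (x∉ ∷ _) (fsuc i) fzero    e = contradiction (≡-sym e) (All.lookup x∉ (∈-lookup i))
Unique⇒lookup-injective (_ ∷ u)  (fsuc i) (fsuc j) e = cong fsuc (Unique⇒lookup-injective u i j e)

-- Choosing a partner for each position of `xs` gives an injection into the positions of `ys`, since
-- a partner determines its `x`. A relation replaces a map because the partner may depend on the
-- proof of membership; repetitions in `ys` do no harm.
length-≤-via : ∀ {A B : Set} {xs : List A} {ys : List B} (R : A → B → Set) → Unique xs →
  (∀ {x} → x ∈ xs → ∃ λ y → y ∈ ys × R x y) →
  (∀ {x x′ y} → R x y → R x′ y → x ≡ x′) →
  length xs ≤ length ys
length-≤-via {xs = xs} {ys} R unique total functional = injective⇒≤ {f = f} f-injective
  where
  image : ∀ i → ∃ λ y → y ∈ ys × R (List.lookup xs i) y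
  image i = total (∈-lookup i)

  f : Fin (length xs) → Fin (length ys)
  f i = Any.index (proj₁ (proj₂ (image i)))

  f-related : ∀ i → R (List.lookup xs i) (List.lookup ys (f i))
  f-related i = subst (R _) (Any.lookup-index (proj₁ (proj₂ (image i)))) (proj₂ (proj₂ (image i)))

  f-injective : Injective _≡_ _≡_ f
  f-injective {i} {j} e = Unique⇒lookup-injective unique i j
    (functional (f-related i) (subst (R _) (cong (List.lookup ys) (≡-sym e)) (f-related j)))

countF-≤ : ∀ {n} {B : Set} {p : Fin n → Bool} {ys : List B} (R : Fin n → B → Set) →
  (∀ {i} → T (p i) → ∃ λ y → y ∈ ys × R i y) →
  (∀ {i j y} → R i y → R j y → i ≡ j) →
  countF p ≤ length ys
countF-≤ {n} {p = p} {ys} R total functional =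
  subst (_≤ length ys) (≡-sym (countL≡length-filter p (allFin n)))
    (length-≤-via R (Unique.filter⁺ (T? ∘ p) (Unique.allFin⁺ n))
      (λ i∈ → total (proj₂ (∈-filter⁻ (T? ∘ p) {xs = allFin n} i∈))) functional)

countF-inj : ∀ {m n} {p : Fin m → Bool} {q : Fin n → Bool} (R : Fin m → Fin n → Set) →
  (∀ {i} → T (p i) → ∃ λ j → T (q j) × R i j) →
  (∀ {i i′ j} → R i j → R i′ j → i ≡ i′) →
  countF p ≤ countF q
countF-inj {n = n} {p} {q} R total functional =
  subst (countF p ≤_) (≡-sym (countL≡length-filter q (allFin n)))
    (countF-≤ R (λ pi → let j , qj , r = total pi in j , ∈-filter⁺ (T? ∘ q) (∈-allFin j) qj , r) functional)

countL-mono-< : ∀ {A : Set} {p q : A → Bool} → (∀ {x} → T (q x) → T (p x)) →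
  ∀ {x xs} → x ∈ xs → T (p x) → ¬ T (q x) → countL q xs < countL p xs
countL-mono-< {A} {p} {q} q⊆p = go
  where
  mono : ∀ xs → countL q xs ≤ countL p xs
  mono [] = z≤n
  mono (x ∷ xs) with q x in qx | p x in px
  ... | true  | true  = s≤s (mono xs)
  ... | true  | false = ⊥-elim (subst T px (q⊆p (from T-≡ qx)))
  ... | false | true  = m≤n⇒m≤1+n (mono xs)
  ... | false | false = mono xs

  go : ∀ {x xs} → x ∈ xs → T (p x) → ¬ T (q x) → countL q xs < countL p xs
  go {x} {_ ∷ xs} (here refl) px ¬qx with q x | p x
  ... | true  | _     = ⊥-elim (¬qx tt)
  ... | false | true  = s≤s (mono xs)
  go {x} {y ∷ xs} (there x∈) px ¬qx with q y in qy | p y in py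
  ... | true  | true  = s≤s (go x∈ px ¬qx)
  ... | true  | false = ⊥-elim (subst T py (q⊆p (from T-≡ qy)))
  ... | false | true  = m≤n⇒m≤1+n (go x∈ px ¬qx)
  ... | false | false = go x∈ px ¬qx

countL-tabulate : ∀ {A : Set} {n} (p : A → Bool) (f : Fin n → A) →
  countL p (tabulate f) ≡ countF (p ∘ f)
countL-tabulate {n = zero}  p f = refl
countL-tabulate {n = suc n} p f =
  cong (λ c → if p (f fzero) then suc c else c)
    (trans (countL-tabulate p (f ∘ fsuc)) (≡-sym (countL-tabulate (p ∘ f) fsuc)))

countF-suc : ∀ {n} (p : Fin (suc n) → Bool) →
  countF p ≡ (if p fzero then suc (countF (p ∘ fsuc)) else countF (p ∘ fsuc))
countF-suc p = cong (λ c → if p fzero then suc c else c) (countL-tabulate p fsuc)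

-- Vectors with a list of options for each coordinate, and their number.

products : ∀ {A : Set} m → (Fin m → List A) → List (Vec A m)
products zero    xss = []ᵥ ∷ []
products (suc m) xss = cartesianProductWith _∷ᵥ_ (xss fzero) (products m (xss ∘ fsuc))

concatMap-map : ∀ {A B C : Set} (f : A → B → C) xs ys →
  concatMap (λ x → map (f x) ys) xs ≡ cartesianProductWith f xs ys
concatMap-map f []       ys = refl
concatMap-map f (x ∷ xs) ys = cong (map (f x) ys ++_) (concatMap-map f xs ys)

vecs≡products : ∀ {A : Set} (xs : List A) m → vecs xs m ≡ products m (const xs)
vecs≡products xs zero    = refl
vecs≡products xs (suc m) =
  trans (concatMap-map _∷ᵥ_ xs (vecs xs m)) (cong (cartesianProductWith _∷ᵥ_ xs) (vecs≡products xs m))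

∈-products : ∀ {A : Set} {m} {xss : Fin m → List A} {v : Vec A m} →
  (∀ i → lookup v i ∈ xss i) → v ∈ products m xss
∈-products {v = []ᵥ}     _  = here refl
∈-products {v = x ∷ᵥ v} v∈ = ∈-cartesianProductWith⁺ _∷ᵥ_ (v∈ fzero) (∈-products (v∈ ∘ fsuc))

∈-products⁻ : ∀ {A : Set} {m} {xss : Fin m → List A} {v : Vec A m} →
  v ∈ products m xss → ∀ i → lookup v i ∈ xss i
∈-products⁻ {m = suc m} {xss} v∈ i
  with ∈-cartesianProductWith⁻ _∷ᵥ_ (xss fzero) (products m (xss ∘ fsuc)) v∈
∈-products⁻ v∈ fzero    | _ , _ , x∈ , u∈ , refl = x∈
∈-products⁻ v∈ (fsuc i) | _ , _ , x∈ , u∈ , refl = ∈-products⁻ u∈ i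

products-Unique : ∀ {A : Set} m {xss : Fin m → List A} → (∀ i → Unique (xss i)) → Unique (products m xss)
products-Unique zero    u = [] ∷ []
products-Unique (suc m) u =
  Unique.cartesianProductWith⁺ _∷ᵥ_ (λ { refl → refl , refl }) (u fzero) (products-Unique m (u ∘ fsuc))

length-cartesianProductWith : ∀ {A B C : Set} (f : A → B → C) xs ys →
  length (cartesianProductWith f xs ys) ≡ length xs * length ys
length-cartesianProductWith f []       ys = refl
length-cartesianProductWith f (x ∷ xs) ys =
  trans (length-++ (map (f x) ys))
    (cong₂ _+_ (length-map (f x) ys) (length-cartesianProductWith f xs ys))

∈-vecs : ∀ {A : Set} {m} {xs : List A} → (∀ x → x ∈ xs) → (v : Vec A m) → v ∈ vecs xs m
∈-vecs {m = m} {xs} all∈ v = subst (v ∈_) (≡-sym (vecs≡products xs m)) (∈-products (λ i → all∈ _))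

vecs-Unique : ∀ {A : Set} m {xs : List A} → Unique xs → Unique (vecs xs m)
vecs-Unique m {xs} u = subst Unique (≡-sym (vecs≡products xs m)) (products-Unique m (const u))

∈-bools : ∀ b → b ∈ bools
∈-bools true  = here refl
∈-bools false = there (here refl)

bools-Unique : Unique bools
bools-Unique = ((λ ()) ∷ []) ∷ [] ∷ []

countF-mono : ∀ {n} {p q : Fin n → Bool} → (∀ {i} → T (p i) → T (q i)) → countF p ≤ countF q
countF-mono {p = p} {q} p⊆q = countF-inj {p = p} {q} _≡_ (λ {i} pi → i , p⊆q pi , refl) (λ { refl refl → refl })

-- Coordinates in `X` contribute a factor `a`, all others a factor `suc b`. As a successor, the
-- latter is at least 1, so its exponent may be raised to `m`, which keeps the constant independent
-- of `X`.
length-products-≤ : ∀ {A : Set} m {xss : Fin m → List A} (X : Fin m → Bool) a b →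
  (∀ i → length (xss i) ≤ (if X i then a else suc b)) →
  length (products m xss) ≤ a ^ countF X * suc b ^ m
length-products-≤ zero X a b h = ≤-refl
length-products-≤ (suc m) {xss} X a b h
  rewrite length-cartesianProductWith _∷ᵥ_ (xss fzero) (products m (xss ∘ fsuc)) | countF-suc X
  with X fzero | h fzero | length-products-≤ m (X ∘ fsuc) a b (h ∘ fsuc)
... | true  | h₀ | ih = begin
  length (xss fzero) * length (products m (xss ∘ fsuc)) ≤⟨ *-mono-≤ h₀ ih ⟩
  a * (a ^ c * suc b ^ m)                                ≡⟨ *-assoc a (a ^ c) (suc b ^ m) ⟨
  a * a ^ c * suc b ^ m                                  ≤⟨ *-monoʳ-≤ (a * a ^ c) (m≤n*m (suc b ^ m) (suc b)) ⟩
  a * a ^ c * (suc b * suc b ^ m)                        ∎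
  where
  open ≤-Reasoning
  c = countF (X ∘ fsuc)
... | false | h₀ | ih = begin
  length (xss fzero) * length (products m (xss ∘ fsuc)) ≤⟨ *-mono-≤ h₀ ih ⟩
  suc b * (a ^ c * suc b ^ m)                            ≡⟨ *-assoc (suc b) (a ^ c) (suc b ^ m) ⟨
  suc b * a ^ c * suc b ^ m                              ≡⟨ cong (_* suc b ^ m) (*-comm (suc b) (a ^ c)) ⟩
  a ^ c * suc b * suc b ^ m                              ≡⟨ *-assoc (a ^ c) (suc b) (suc b ^ m) ⟩
  a ^ c * (suc b * suc b ^ m)                            ∎
  where
  open ≤-Reasoning
  c = countF (X ∘ fsuc)

length-products-≥ : ∀ {A : Set} m {xss : Fin m → List A} (X : Fin m → Bool) a →
  (∀ i → (if X i then a else 1) ≤ length (xss i)) →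
  a ^ countF X ≤ length (products m xss)
length-products-≥ zero X a h = ≤-refl
length-products-≥ (suc m) {xss} X a h
  rewrite length-cartesianProductWith _∷ᵥ_ (xss fzero) (products m (xss ∘ fsuc)) | countF-suc X
  with X fzero | h fzero | length-products-≥ m (X ∘ fsuc) a (h ∘ fsuc)
... | true  | h₀ | ih = *-mono-≤ h₀ ih
... | false | h₀ | ih = ≤-trans (≤-reflexive (≡-sym (*-identityˡ _))) (*-mono-≤ h₀ ih)

length-concatMap-≤ : ∀ {A B : Set} (f : A → List B) xs b → (∀ {x} → x ∈ xs → length (f x) ≤ b) →
  length (concatMap f xs) ≤ length xs * b
length-concatMap-≤ f []       b h = z≤n
length-concatMap-≤ f (x ∷ xs) b h = ≤-trans (≤-reflexive (length-++ (f x)))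
  (+-mono-≤ (h (here refl)) (length-concatMap-≤ f xs b (h ∘ there)))

-- Stable sets of low-degree vertices and their maximum size.

record LowStable {m} (H : Graph m) (s : ℕ) (X : Vec Bool m) : Set where
  field
    low    : ∀ {i} → T (lookup X i) → degree H i ≤ s
    stable : ∀ {i j} → T (lookup X i) → T (lookup X j) → ¬ T (adj H i j)

T-isLowStable : ∀ {m} {H : Graph m} {s X} → T (isLowStable H s X) ⇔ LowStable H s X
T-isLowStable {m} {H} {s} {X} = mk⇔
  (λ t → let l , st = to T-∧ t in record
    { low    = λ {i} Xi → ≤ᵇ⇒≤ (degree H i) s (to T-⇒ (to T-allV l i) Xi)
    ; stable = λ {i} {j} Xi Xj → to T-not (to T-⇒ (to T-allV (to T-allV st i) j) (from T-∧ (Xi , Xj))) })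
  (λ ls → from (T-∧ {allV m λ i → lookup X i ⇒ᵇ (degree H i ≤ᵇ s)})
    ( from (T-allV {m}) (λ i → from T-⇒ (λ Xi → ≤⇒≤ᵇ (LowStable.low ls Xi)))
    , from (T-allV {m}) (λ i → from (T-allV {m}) (λ j → from T-⇒ (λ XiXj →
        let Xi , Xj = to T-∧ XiXj in from T-not (LowStable.stable ls Xi Xj))))))

≤-maximum : ∀ {A : Set} (f : A → ℕ) {x xs} → x ∈ xs → f x ≤ foldr _⊔_ 0 (map f xs)
≤-maximum f {xs = y ∷ xs} (here refl) = m≤m⊔n (f y) _
≤-maximum f {xs = y ∷ xs} (there x∈)  = ≤-trans (≤-maximum f x∈) (m≤n⊔m (f y) _)

-- The second alternative absorbs the default 0 of the empty list, which no element attains.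
maximum-attained : ∀ {A : Set} (f : A → ℕ) xs →
  (∃ λ x → foldr _⊔_ 0 (map f xs) ≤ f x) ⊎ foldr _⊔_ 0 (map f xs) ≡ 0
maximum-attained f [] = inj₂ refl
maximum-attained f (y ∷ xs) with ⊔-sel (f y) (foldr _⊔_ 0 (map f xs)) | maximum-attained f xs
... | inj₁ e | _              = inj₁ (y , ≤-reflexive e)
... | inj₂ e | inj₁ (x , le)  = inj₁ (x , ≤-trans (≤-reflexive e) le)
... | inj₂ e | inj₂ max≡0     = inj₂ (trans e max≡0)

size≤alpha : ∀ {m} {H : Graph m} {s X} → LowStable H s X → size X ≤ alpha H s
size≤alpha {H = H} {s} {X} ls =
  ≤-trans (≤-reflexive (cong (λ b → if b then size X else 0)
             (≡-sym (to T-≡ (from (T-isLowStable {H = H} {X = X}) ls)))))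
    (≤-maximum (λ S → if isLowStable H s S then size S else 0) (∈-vecs ∈-bools X))

∅-LowStable : ∀ {m} {H : Graph m} {s} → LowStable H s (Vec.replicate m false)
∅-LowStable {m} = record { low = λ {i} t → ⊥-elim (∉∅ i t) ; stable = λ {i} t → ⊥-elim (∉∅ i t) }
  where
  ∉∅ : ∀ i → ¬ T (lookup (Vec.replicate m false) i)
  ∉∅ i t = subst T (Vec.lookup-replicate i false) t

alpha-attained : ∀ {m} (H : Graph m) s → ∃ λ X → LowStable H s X × alpha H s ≤ size X
alpha-attained {m} H s with maximum-attained (λ S → if isLowStable H s S then size S else 0) (vecs bools m)
... | inj₂ e = _ , ∅-LowStable , ≤-trans (≤-reflexive e) z≤n
... | inj₁ (X , le) with isLowStable H s X in eq
...   | true  = X , to T-isLowStable (from T-≡ eq) , le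
-- The maximiser contributes only the default 0 here, so the empty set does as well.
...   | false = _ , ∅-LowStable , ≤-trans le z≤n

-- Copies as images of embeddings.

record IsCopyVia {m n} (H : Graph m) (G : Graph n) (S : Vec Bool n) (E : Vec (Vec Bool n) n)
                 (σ : Vec (Fin n) m) : Set where
  field
    E-sym     : ∀ i j → lookup (lookup E i) j ≡ lookup (lookup E j) i
    E⊆G       : ∀ {i j} → T (lookup (lookup E i) j) → T (adj G i j) × T (lookup S i) × T (lookup S j)
    injective : ∀ {i j} → lookup σ i ≡ lookup σ j → i ≡ j
    image     : ∀ {v} → T (lookup S v) ⇔ (∃ λ i → lookup σ i ≡ v)
    edges     : ∀ i j → lookup (lookup E (lookup σ i)) (lookup σ j) ≡ adj H i j

isCopy-sound : ∀ {m n} {H : Graph m} {G : Graph n} {S E} → T (isCopy H G (S , E)) →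
  ∃ λ σ → IsCopyVia H G S E σ
isCopy-sound {m} {n} {H} {G} {S} {E} t =
  let sub , via       = to T-∧ t
      σ , tσ          = Any.satisfied (Any.any⁻ (isIsoVia H S E) (vecs (allFin n) m) via)
      inj , tσ′       = to T-∧ tσ
      img , edg       = to (T-∧ {allV n λ v → eqB (lookup S v) (anyV m λ i → lookup σ i ≟ᶠ v)}) tσ′
      image-at v      = to T-eqB (to T-allV img v)
  in σ , record
    { E-sym     = λ i j → to T-eqB (proj₁ (to T-∧ (to T-allV (to T-allV sub i) j)))
    ; E⊆G       = λ {i} {j} e →
        let a , b = to T-∧ (to T-⇒ (proj₂ (to (T-∧ {eqB (lookup (lookup E i) j) _}) (to T-allV (to T-allV sub i) j))) e)
        in a , to T-∧ b
    ; injective = λ {i} {j} e → to T-≟ᶠ (to T-⇒ (to T-allV (to T-allV inj i) j) (from T-≟ᶠ e))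
    ; image     = λ {v} → mk⇔
        (λ Sv → let i , e = to T-anyV (subst T (image-at v) Sv) in i , to T-≟ᶠ e)
        (λ { (i , e) → subst T (≡-sym (image-at v)) (from T-anyV (i , from T-≟ᶠ e)) })
    ; edges     = λ i j → to T-eqB (to T-allV (to T-allV edg i) j)
    }

isCopy-complete : ∀ {m n} {H : Graph m} {G : Graph n} {S E σ} → IsCopyVia H G S E σ →
  T (isCopy H G (S , E))
isCopy-complete {m} {n} {H} {G} {S} {E} {σ} c = from T-∧
  ( from (T-allV {n}) (λ i → from (T-allV {n}) (λ j → from T-∧
      ( from T-eqB (E-sym i j)
      , from T-⇒ (λ e → let a , s , s′ = E⊆G e in from T-∧ (a , from T-∧ (s , s′))))))
  , Any.any⁺ (isIsoVia H S E) (lose (∈-vecs ∈-allFin σ) (from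
    (T-∧ {allV m λ i → allV m λ j → (lookup σ i ≟ᶠ lookup σ j) ⇒ᵇ (i ≟ᶠ j)})
      ( from (T-allV {m}) (λ i → from (T-allV {m}) (λ j → from T-⇒ (λ e → from T-≟ᶠ (injective (to T-≟ᶠ e)))))
      , from (T-∧ {allV n λ v → eqB (lookup S v) (anyV m λ i → lookup σ i ≟ᶠ v)})
        ( from (T-allV {n}) (λ v → from T-eqB (T-ext
            (λ Sv → let i , e = to image Sv in from T-anyV (i , from T-≟ᶠ e))
            (λ t → let i , e = to T-anyV t in from image (i , to T-≟ᶠ e))))
        , from (T-allV {m}) (λ i → from (T-allV {m}) (λ j → from T-eqB (edges i j)))))))
  )
  where open IsCopyVia c

-- The vertex set is the image of `σ`, every edge has both ends in it, and on the image the edges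
-- are dictated by `H`. The number of copies can therefore be bounded by counting embeddings.
isCopyVia-unique : ∀ {m n} {H : Graph m} {G : Graph n} {S E S′ E′ σ} →
  IsCopyVia H G S E σ → IsCopyVia H G S′ E′ σ → (S , E) ≡ (S′ , E′)
isCopyVia-unique {H = H} {G} {σ = σ} c c′ = cong₂ _,_
  (lookup-ext (λ v → T-ext (S⊆ c c′) (S⊆ c′ c)))
  (lookup-ext (λ v → lookup-ext (λ w → T-ext (E⊆ c c′) (E⊆ c′ c))))
  where
  S⊆ : ∀ {S E S′ E′} → IsCopyVia H G S E σ → IsCopyVia H G S′ E′ σ →
    ∀ {v} → T (lookup S v) → T (lookup S′ v)
  S⊆ c c′ = from (IsCopyVia.image c′) ∘ to (IsCopyVia.image c)

  E⊆ : ∀ {S E S′ E′} → IsCopyVia H G S E σ → IsCopyVia H G S′ E′ σ →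
    ∀ {v w} → T (lookup (lookup E v) w) → T (lookup (lookup E′ v) w)
  E⊆ c c′ e with IsCopyVia.E⊆G c e
  ... | _ , Sv , Sw with to (IsCopyVia.image c) Sv | to (IsCopyVia.image c) Sw
  ...   | i , refl | j , refl = subst T (trans (IsCopyVia.edges c i j) (≡-sym (IsCopyVia.edges c′ i j))) e

subgraphs : ∀ n → List (Vec Bool n × Vec (Vec Bool n) n)
subgraphs n = cartesianProduct (vecs bools n) (vecs (vecs bools n) n)

copies≡length : ∀ {m n} (H : Graph m) (G : Graph n) →
  copies H G ≡ length (filter (T? ∘ isCopy H G) (subgraphs n))
copies≡length {n = n} H G = trans
  (cong (countL (isCopy H G)) (concatMap-map _,_ (vecs bools n) (vecs (vecs bools n) n)))
  (countL≡length-filter (isCopy H G) (subgraphs n))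

subgraphs-Unique : ∀ n → Unique (subgraphs n)
subgraphs-Unique n = Unique.cartesianProduct⁺ (vecs-Unique n bools-Unique) (vecs-Unique n (vecs-Unique n bools-Unique))

∈-subgraphs : ∀ {n} S E → (S , E) ∈ subgraphs n
∈-subgraphs S E = ∈-cartesianProduct⁺ (∈-vecs ∈-bools S) (∈-vecs (∈-vecs ∈-bools) E)

-- Elimination orders of degenerate graphs.

-- The index is compared through `toℕ`, so that `j` ranges over a fixed `Fin k` whatever the number
-- of vertices satisfying `p`.
IsNth : ∀ {n k} → (Fin n → Bool) → Fin n → Fin k → Set
IsNth {n} p v j = ∃ λ i → List.lookup (filter (T? ∘ p) (allFin n)) i ≡ v × toℕ i ≡ toℕ j

IsNth-functional : ∀ {n k} {p : Fin n → Bool} {v w} {j : Fin k} → IsNth p v j → IsNth p w j → v ≡ w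
IsNth-functional {n} {p = p} (i , refl , e) (i′ , refl , e′) =
  cong (List.lookup (filter (T? ∘ p) (allFin n))) (toℕ-injective (trans e (≡-sym e′)))

IsNth-total : ∀ {n k} {p : Fin n → Bool} {v} → countF p ≤ k → T (p v) → ∃ λ (j : Fin k) → IsNth p v j
IsNth-total {n} {k} {p} {v} le pv = Fin.inject≤ i le′ , i , ≡-sym (Any.lookup-index v∈) , ≡-sym (Fin.toℕ-inject≤ i le′)
  where
  v∈ : v ∈ filter (T? ∘ p) (allFin n)
  v∈ = ∈-filter⁺ (T? ∘ p) (∈-allFin v) pv
  i = Any.index v∈
  le′ = subst (_≤ k) (countL≡length-filter p (allFin n)) le

later : ∀ {n} → Graph n → (Fin n → ℕ) → (Fin n → Bool) → Fin n → Fin n → Bool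
later G rank S u v = adj G u v ∧ S v ∧ (rank u <ᵇ rank v)

T-later : ∀ {n} (G : Graph n) rank S {u v} →
  T (later G rank S u v) ⇔ (T (adj G u v) × T (S v) × rank u < rank v)
T-later G rank S {u} {v} = mk⇔
  (λ t → let a , t′ = to (T-∧ {adj G u v}) t ; Sv , lt = to (T-∧ {S v}) t′ in a , Sv , <ᵇ⇒< (rank u) (rank v) lt)
  (λ { (a , Sv , lt) → from (T-∧ {adj G u v}) (a , from (T-∧ {S v}) (Sv , <⇒<ᵇ lt)) })

-- The ranks orient every edge inside `S` towards its larger end, with out-degree at most `k`.
-- Vertices that are not adjacent may share a rank.
record Elimination {n} (k : ℕ) (G : Graph n) (S : Fin n → Bool) : Set where
  field
    rank   : Fin n → ℕ
    rank-≢ : ∀ {u v} → T (S u) → T (S v) → T (adj G u v) → rank u ≢ rank v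
    later≤ : ∀ {u} → T (S u) → countF (later G rank S u) ≤ k

adj-irrefl : ∀ {n} (G : Graph n) {v} → ¬ T (adj G v v)
adj-irrefl G {v} = subst T (irrefl G v)

adj-sym : ∀ {n} (G : Graph n) {u v} → T (adj G u v) → T (adj G v u)
adj-sym G {u} {v} = subst T (sym G u v)

induced : ∀ {n} → Graph n → (Fin n → Bool) → Fin n → Fin n → Bool
induced G S u v = adj G u v ∧ S u ∧ S v

T-induced : ∀ {n} (G : Graph n) S {u v} → T (induced G S u v) ⇔ (T (adj G u v) × T (S u) × T (S v))
T-induced G S {u} {v} = mk⇔
  (λ t → let a , t′ = to (T-∧ {adj G u v}) t in a , to (T-∧ {S u}) t′)
  (λ { (a , Su , Sv) → from (T-∧ {adj G u v}) (a , from (T-∧ {S u}) (Su , Sv)) })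

induced-sym : ∀ {n} (G : Graph n) S u v → induced G S u v ≡ induced G S v u
induced-sym G S u v = cong₂ _∧_ (sym G u v) (∧-comm (S u) (S v))

prepend : ∀ {n} → Fin n → (Fin n → ℕ) → Fin n → ℕ
prepend v rank u with u Fin.≟ v
... | yes _ = 0
... | no  _ = suc (rank u)

prepend-≡ : ∀ {n} (v : Fin n) rank → prepend v rank v ≡ 0
prepend-≡ v rank with v Fin.≟ v
... | yes _  = refl
... | no v≢v = contradiction refl v≢v

prepend-≢ : ∀ {n} {v u : Fin n} rank → u ≢ v → prepend v rank u ≡ suc (rank u)
prepend-≢ {v = v} {u} rank u≢v with u Fin.≟ v
... | yes u≡v = contradiction u≡v u≢v
... | no  _   = refl

-- `v` receives rank 0 and all other ranks go up by one. The later neighbours of `v` are among its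
-- at most `k` neighbours in `S`; no other vertex gains a later neighbour, because rank 0 exceeds
-- nothing.
elimination-prepend : ∀ {n k} {G : Graph n} {S : Fin n → Bool} v → T (S v) →
  countF (induced G S v) ≤ k → Elimination k G (λ u → S u ∧ not (u ≟ᶠ v)) → Elimination k G S
elimination-prepend {n} {k} {G} {S} v Sv le el =
  record { rank = rank′ ; rank-≢ = rank-≢′ ; later≤ = λ {u} → later≤′ (u Fin.≟ v) }
  where
  open Elimination el
  rank′ = prepend v rank

  S∖v : ∀ {u} → T (S u) → u ≢ v → T (S u ∧ not (u ≟ᶠ v))
  S∖v Su u≢v = from T-∧ (Su , from T-not (u≢v ∘ to T-≟ᶠ))

  rank-≢′ : ∀ {u w} → T (S u) → T (S w) → T (adj G u w) → rank′ u ≢ rank′ w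
  rank-≢′ {u} {w} Su Sw a e with u Fin.≟ v | w Fin.≟ v
  ... | yes refl | yes refl = adj-irrefl G a
  ... | yes refl | no w≢v   = 0≢1+n e
  ... | no u≢v   | yes refl = 0≢1+n (≡-sym e)
  ... | no u≢v   | no w≢v   = rank-≢ (S∖v Su u≢v) (S∖v Sw w≢v) a (suc-injective e)

  later≤′ : ∀ {u} → Dec (u ≡ v) → T (S u) → countF (later G rank′ S u) ≤ k
  later≤′ {u} (yes refl) Su = ≤-trans (countF-mono {p = later G rank′ S v} {induced G S v} (λ t →
          let a , Sw , _ = to (T-later G rank′ S) t in from (T-induced G S) (a , Su , Sw))) le
  later≤′ {u} (no u≢v) Su = ≤-trans
    (countF-mono {p = later G rank′ S u} {later G rank _ u} shrink)
    (later≤ (S∖v Su u≢v))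
    where
    shrink : ∀ {w} → T (later G rank′ S u w) → T (later G rank (λ x → S x ∧ not (x ≟ᶠ v)) u w)
    shrink {w} t with to (T-later G rank′ S) t
    ... | a , Sw , lt = from (T-later G rank (λ x → S x ∧ not (x ≟ᶠ v))) (a , S∖v Sw w≢v , ≤-pred lt′)
      where
      w≢v : w ≢ v
      w≢v refl = n≮0 (subst (rank′ u <_) (prepend-≡ w rank) lt)
      lt′ : suc (rank u) < suc (rank w)
      lt′ = subst₂ _<_ (prepend-≢ rank u≢v) (prepend-≢ rank w≢v) lt

-- Degeneracy, applied to the subgraph induced on `S`, yields a vertex to rank first; the rest of
-- `S` is handled recursively. The bound `c` makes the recursion structural.
Degenerate⇒Elimination : ∀ {n k} {G : Graph n} → Degenerate k G →
  ∀ c S → countF S ≤ c → Elimination k G S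
Degenerate⇒Elimination {n} {k} {G} deg c S le with any? (T? ∘ S)
... | no ¬∃ = record
  { rank   = const 0
  ; rank-≢ = λ Su → ⊥-elim (¬∃ (_ , Su))
  ; later≤ = λ Su → ⊥-elim (¬∃ (_ , Su))
  }
... | yes (x , Sx) with deg S (induced G S) (induced-sym G S) (λ _ _ t → t) (x , Sx)
-- Deleting `v` strictly lowers the count, so `c` is positive and its predecessor bounds what is
-- left.
...   | v , Sv , le-k with c | ≤-trans (countL-mono-< {p = S} {λ u → S u ∧ not (u ≟ᶠ v)}
                          (λ t → proj₁ (to T-∧ t)) (∈-allFin v) Sv
                          (λ t → to T-not (proj₂ (to (T-∧ {S v}) t)) (from (T-≟ᶠ {i = v}) refl))) le
...     | zero   | ()
...     | suc c′ | s≤s le′ = elimination-prepend v Sv le-k (Degenerate⇒Elimination deg c′ _ le′)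

-- Upper bound: encoding copies.

Code : ℕ → ℕ → ℕ → Set
Code m n k = Fin n ⊎ (Fin m × Fin k)

-- The Boolean says whether the coordinate stores an image, with `n` options, or a neighbour and a
-- position, with only `m * k` options.
codeAt : ∀ m n k → Bool → List (Code m n k)
codeAt m n k true  = map inj₁ (allFin n)
codeAt m n k false = map inj₂ (cartesianProduct (allFin m) (allFin k))

length-codeAt : ∀ m n k b → length (codeAt m n k b) ≤ (if b then n else suc (m * k))
length-codeAt m n k true  = ≤-reflexive (trans (length-map inj₁ (allFin n)) (length-tabulate {n = n} id))
length-codeAt m n k false = ≤-trans (≤-reflexive (trans (length-map inj₂ (cartesianProduct (allFin m) (allFin k)))
  (trans (length-cartesianProductWith _,_ (allFin m) (allFin k))
    (cong₂ _*_ (length-tabulate {n = m} id) (length-tabulate {n = k} id))))) (n≤1+n (m * k))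

-- The set of coordinates that store images varies with the copy, so all low stable sets are listed;
-- their number is bounded in terms of `m` alone.
codes : ∀ {m} (F : Graph m) (n k : ℕ) → List (Vec (Code m n k) m)
codes {m} F n k = concatMap (λ X → products m (codeAt m n k ∘ lookup X))
                    (filter (T? ∘ isLowStable F k) (vecs bools m))

length-codes : ∀ {m} (F : Graph m) n k → 1 ≤ n →
  length (codes F n k) ≤ length (vecs bools m) * suc (m * k) ^ m * n ^ alpha F k
length-codes {m} F n@(suc _) k _ = begin
  length (codes F n k)
    ≤⟨ length-concatMap-≤ (λ X → products m (codeAt m n k ∘ lookup X)) lowStables (n ^ α * B) bound ⟩
  length lowStables * (n ^ α * B)
    ≤⟨ *-monoˡ-≤ (n ^ α * B) (length-filter (T? ∘ isLowStable F k) (vecs bools m)) ⟩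
  length (vecs bools m) * (n ^ α * B)
    ≡⟨ cong (length (vecs bools m) *_) (*-comm (n ^ α) B) ⟩
  length (vecs bools m) * (B * n ^ α)
    ≡⟨ *-assoc (length (vecs bools m)) B (n ^ α) ⟨
  length (vecs bools m) * B * n ^ α ∎
  where
  open ≤-Reasoning
  α = alpha F k
  B = suc (m * k) ^ m
  lowStables = filter (T? ∘ isLowStable F k) (vecs bools m)
  bound : ∀ {X} → X ∈ lowStables → length (products m (codeAt m n k ∘ lookup X)) ≤ n ^ α * B
  -- `size X` is at most `α` since `X` is low and stable, and powers of the positive number `n` are
  -- monotone in the exponent.
  bound {X} X∈ = ≤-trans (length-products-≤ m (lookup X) n (m * k) (λ i → length-codeAt m n k (lookup X i)))
    (*-monoˡ-≤ B (^-monoʳ-≤ n (size≤alpha {X = X}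
      (to (T-isLowStable {H = F} {X = X}) (proj₂ (∈-filter⁻ (T? ∘ isLowStable F k) {xs = vecs bools m} X∈))))))

-- An embedding σ is coded vertex by vertex: a vertex of F whose neighbours all
-- have larger rank stores its image; any other vertex x stores a neighbour y of
-- smaller rank and the position of σ x among the at most k later neighbours of σ y.
Encodes : ∀ {m n k} (G : Graph n) → (Fin n → ℕ) → Vec (Fin n) m → Fin m → Code m n k → Set
Encodes G rank σ x (inj₁ v)       = lookup σ x ≡ v
Encodes G rank σ x (inj₂ (y , j)) = rank (lookup σ y) < rank (lookup σ x)
  × IsNth (later G rank (const true) (lookup σ y)) (lookup σ x) j

-- Induction on the rank of `σ x`. A stored image is read off directly; otherwise the code names
-- some `y` whose image has smaller rank, hence is already known to agree, and the stored position
-- singles out one later neighbour of that image.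
decode-unique : ∀ {m n k} {G : Graph n} {rank} {σ σ′ : Vec (Fin n) m} {c : Vec (Code m n k) m} →
  (∀ x → Encodes G rank σ x (lookup c x)) → (∀ x → Encodes G rank σ′ x (lookup c x)) → σ ≡ σ′
decode-unique {G = G} {rank} {σ} {σ′} {c} enc enc′ = lookup-ext (λ x → agree (suc (rank (lookup σ x))) x ≤-refl)
  where
  agree : ∀ r x → rank (lookup σ x) < r → lookup σ x ≡ lookup σ′ x
  agree (suc r) x (s≤s le) with lookup c x | enc x | enc′ x
  ... | inj₁ v       | e        | e′        = trans e (≡-sym e′)
  ... | inj₂ (y , j) | lt , nth | _ , nth′  = IsNth-functional nth
    (subst (λ u → IsNth (later G rank (const true) u) (lookup σ′ x) j)
      (≡-sym (agree r y (<-≤-trans lt le))) nth′)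

module Sources {m n k} {F : Graph m} {G : Graph n} (el : Elimination k G (const true))
               {S E σ} (copy : IsCopyVia F G S E σ) where
  open Elimination el
  open IsCopyVia copy

  isSource : Fin m → Bool
  isSource x = allV m λ y → adj F x y ⇒ᵇ (rank (lookup σ x) <ᵇ rank (lookup σ y))

  sources : Vec Bool m
  sources = Vec.tabulate isSource

  lookup-sources : ∀ x → lookup sources x ≡ isSource x
  lookup-sources = Vec.lookup∘tabulate isSource

  σ-adj : ∀ {x y} → T (adj F x y) → T (adj G (lookup σ x) (lookup σ y))
  σ-adj {x} {y} a = proj₁ (E⊆G (subst T (≡-sym (edges x y)) a))

  source-< : ∀ {x y} → T (lookup sources x) → T (adj F x y) → rank (lookup σ x) < rank (lookup σ y)
  source-< {x} {y} s a = <ᵇ⇒< _ _ (to T-⇒ (to T-allV (subst T (lookup-sources x) s) y) a)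

  -- The neighbours of a source are sent injectively by `σ` to later neighbours of its image, of
  -- which there are at most `k`. Two adjacent sources would each have to precede the other.
  sources-LowStable : LowStable F k sources
  sources-LowStable = record
    { low    = λ {x} s → ≤-trans
        (countF-inj {p = adj F x} {later G rank (const true) (lookup σ x)} (λ y v → lookup σ y ≡ v)
          (λ {y} a → lookup σ y , from (T-later G rank _) (σ-adj a , tt , source-< s a) , refl)
          (λ { refl e → injective (≡-sym e) }))
        (later≤ tt)
    ; stable = λ s s′ a → <-asym (source-< s a) (source-< s′ (adj-sym F a))
    }

  -- A vertex that is not a source has a neighbour `y` whose image has no larger rank. Ranks differ
  -- along edges, so the inequality is strict and `σ x` is a later neighbour of `σ y`.
  code : ∀ x → ∃ λ a → a ∈ codeAt m n k (lookup sources x) × Encodes G rank σ x a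
  code x with lookup sources x in eq
  ... | true  = inj₁ (lookup σ x) , ∈-map⁺ inj₁ (∈-allFin _) , refl
  ... | false with Fin.¬∀⟶∃¬ m _ (λ y → T? (adj F x y ⇒ᵇ (rank (lookup σ x) <ᵇ rank (lookup σ y))))
                     (λ all → subst T (trans (≡-sym (lookup-sources x)) eq) (from T-allV all))
  ...   | y , ¬imp with adj F x y in xy
  ...     | false = contradiction tt ¬imp
  ...     | true  =
    let a        = adj-sym G (σ-adj (from T-≡ xy))
        lt       = ≤∧≢⇒< (≮⇒≥ (¬imp ∘ <⇒<ᵇ)) (rank-≢ tt tt a)
        j , nth  = IsNth-total (later≤ tt) (from (T-later G rank _) (a , tt , lt))
    in inj₂ (y , j) , ∈-map⁺ inj₂ (∈-cartesianProduct⁺ (∈-allFin y) (∈-allFin j)) , lt , nth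

  codeVec : Vec (Code m n k) m
  codeVec = Vec.tabulate (proj₁ ∘ code)

  codeVec-Encodes : ∀ x → Encodes G rank σ x (lookup codeVec x)
  codeVec-Encodes x = subst (Encodes G rank σ x) (≡-sym (Vec.lookup∘tabulate (proj₁ ∘ code) x)) (proj₂ (proj₂ (code x)))

  codeVec-∈ : codeVec ∈ codes F n k
  codeVec-∈ = ∈-concatMap⁺ (λ X → products m (codeAt m n k ∘ lookup X)) (lose
    (∈-filter⁺ (T? ∘ isLowStable F k) (∈-vecs ∈-bools sources) (from T-isLowStable sources-LowStable))
    (∈-products (λ x → subst (_∈ codeAt m n k (lookup sources x))
      (≡-sym (Vec.lookup∘tabulate (proj₁ ∘ code) x)) (proj₁ (proj₂ (code x))))))

-- Each copy has an embedding and hence a code. Two copies sharing a code share the embedding by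
-- `decode-unique`, so they coincide.
copies-≤ : ∀ {m n k} (F : Graph m) (G : Graph n) → 1 ≤ n → Degenerate k G →
  copies F G ≤ length (vecs bools m) * suc (m * k) ^ m * n ^ alpha F k
copies-≤ {m} {n} {k} F G 1≤n deg = ≤-trans (≤-reflexive (copies≡length F G))
  (≤-trans (length-≤-via {ys = codes F n k} R (Unique.filter⁺ (T? ∘ isCopy F G) (subgraphs-Unique n)) total
      (λ {_} {_} {c} → functional {c = c}))
    (length-codes F n k 1≤n))
  where
  el = Degenerate⇒Elimination deg (countF {n} (const true)) (const true) ≤-refl
  open Elimination el using (rank)

  -- A copy may arise from several embeddings; a code of any of them is accepted.
  R : Vec Bool n × Vec (Vec Bool n) n → Vec (Code m n k) m → Set
  R (S , E) c = ∃ λ σ → IsCopyVia F G S E σ × (∀ x → Encodes G rank σ x (lookup c x))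

  total : ∀ {x} → x ∈ filter (T? ∘ isCopy F G) (subgraphs n) → ∃ λ c → c ∈ codes F n k × R x c
  total {S , E} x∈ =
    let σ , copy = isCopy-sound (proj₂ (∈-filter⁻ (T? ∘ isCopy F G) {xs = subgraphs n} x∈))
        open Sources el copy
    in codeVec , codeVec-∈ , σ , copy , codeVec-Encodes

  functional : ∀ {x x′ c} → R x c → R x′ c → x ≡ x′
  functional {c = c} (σ , copy , enc) (σ′ , copy′ , enc′) with decode-unique {c = c} enc enc′
  ... | refl = isCopyVia-unique copy copy′

-- Minimum degree two forces a cycle.

-- The function is total on the naturals but constrained only up to `L`, so a path is shortened
-- without reindexing.
record Path {n} (E : Fin n → Fin n → Bool) (L : ℕ) : Set where
  field
    at     : ℕ → Fin n
    at-inj : ∀ {i j} → i ≤ L → j ≤ L → at i ≡ at j → i ≡ j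
    step   : ∀ {i} → i < L → T (E (at i) (at (suc i)))

-- A path on `l + 3` vertices with a closing edge, indexed as in `Forest`.
record Cycle {n} (E : Fin n → Fin n → Bool) : Set where
  field
    l     : ℕ
    path  : Path E (suc (suc l))
    close : T (E (Path.at path (suc (suc l))) (Path.at path 0))

module _ {n} {S : Fin n → Bool} {E : Fin n → Fin n → Bool}
         (E-sym : ∀ u v → E u v ≡ E v u) (E-irrefl : ∀ {v} → ¬ T (E v v))
         (E⊆S : ∀ {u v} → T (E u v) → T (S u))
         (branching : ∀ {v} → T (S v) → ∀ u → ∃ λ w → w ≢ u × T (E v w)) where

  open Path

  E-flip : ∀ {u v} → T (E u v) → T (E v u)
  E-flip {u} {v} = subst T (E-sym u v)

  -- The first vertex has a neighbour `w` other than the second one. If `w` lies further along the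
  -- path, the edge to it closes a cycle; otherwise `w` is new and is put in front.
  extend : ∀ {L} → Path E (suc L) → Path E (suc (suc L)) ⊎ Cycle E
  extend {L} P with branching (E⊆S (step P (s≤s z≤n))) (at P 1)
  ... | w , w≢ , e with any? {n = suc (suc L)} (λ i → at P (toℕ i) Fin.≟ w)
  ...   | yes (fzero , refl)         = ⊥-elim (E-irrefl e)
  ...   | yes (fsuc fzero , refl)    = contradiction refl w≢
  ...   | yes (fsuc (fsuc j) , refl) = inj₂ (record
    { l     = toℕ j
    ; path  = record
      { at     = at P
      ; at-inj = λ i≤ j≤ → at-inj P (≤-trans i≤ l≤L) (≤-trans j≤ l≤L)
      ; step   = λ i< → step P (<-≤-trans i< l≤L)
      }
    ; close = E-flip e
    })
    where
    l≤L : suc (suc (toℕ j)) ≤ suc L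
    l≤L = s≤s (Fin.toℕ<n j)
  ...   | no new = inj₁ (record { at = at′ ; at-inj = at′-inj ; step = step′ })
    where
    at′ : ℕ → Fin n
    at′ zero    = w
    at′ (suc i) = at P i

    fresh : ∀ {i} → i ≤ suc L → at P i ≢ w
    fresh i≤ eq = new (Fin.fromℕ< (s≤s i≤) , trans (cong (at P) (Fin.toℕ-fromℕ< (s≤s i≤))) eq)

    at′-inj : ∀ {i j} → i ≤ suc (suc L) → j ≤ suc (suc L) → at′ i ≡ at′ j → i ≡ j
    at′-inj {zero}  {zero}  _        _        _  = refl
    at′-inj {zero}  {suc j} _        (s≤s j≤) eq = contradiction (≡-sym eq) (fresh j≤)
    at′-inj {suc i} {zero}  (s≤s i≤) _        eq = contradiction eq (fresh i≤)
    at′-inj {suc i} {suc j} (s≤s i≤) (s≤s j≤) eq = cong suc (at-inj P i≤ j≤ eq)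

    step′ : ∀ {i} → i < suc (suc L) → T (E (at′ i) (at′ (suc i)))
    step′ {zero}  _        = E-flip e
    step′ {suc i} (s≤s i<) = step P i<

  path-or-cycle : ∃ (T ∘ S) → ∀ L → Path E (suc L) ⊎ Cycle E
  path-or-cycle (v , Sv) zero with branching Sv v
  ... | w , w≢v , e = inj₁ (record { at = at₀ ; at-inj = at₀-inj ; step = λ { (s≤s z≤n) → e } })
    where
    at₀ : ℕ → Fin n
    at₀ zero    = v
    at₀ (suc _) = w

    at₀-inj : ∀ {i j} → i ≤ 1 → j ≤ 1 → at₀ i ≡ at₀ j → i ≡ j
    at₀-inj z≤n       z≤n       _  = refl
    at₀-inj z≤n       (s≤s z≤n) eq = contradiction (≡-sym eq) w≢v
    at₀-inj (s≤s z≤n) z≤n       eq = contradiction eq w≢v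
    at₀-inj (s≤s z≤n) (s≤s z≤n) _  = refl
  path-or-cycle x (suc L) with path-or-cycle x L
  ... | inj₁ P = extend P
  ... | inj₂ C = inj₂ C

  -- A path with `n + 2` distinct vertices does not fit into `Fin n`, so extending paths must close
  -- a cycle at some stage.
  branching⇒Cycle : ∃ (T ∘ S) → Cycle E
  branching⇒Cycle x with path-or-cycle x n
  ... | inj₂ C = C
  ... | inj₁ P = contradiction (injective⇒≤ {m = suc (suc n)} {f = at P ∘ toℕ}
          (λ {i} {j} eq → toℕ-injective (at-inj P (≤-pred (Fin.toℕ<n i)) (≤-pred (Fin.toℕ<n j)) eq)))
        (<⇒≱ (m<n⇒m<1+n (n<1+n n)))

-- Turns the absence of vertices of degree at most 1 into the hypothesis `branching`.
countF≰1⇒other : ∀ {n} {p : Fin n → Bool} → ¬ (countF p ≤ 1) → ∀ u → ∃ λ w → w ≢ u × T (p w)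
countF≰1⇒other {p = p} ≰1 u with any? (λ w → ¬? (w Fin.≟ u) ×-dec T? (p w))
... | yes found = found
... | no ¬found = contradiction
  (countF-≤ {p = p} {ys = u ∷ []} _≡_
    (λ {w} pw → u , here refl , decidable-stable (w Fin.≟ u) (λ w≢u → ¬found (w , w≢u , pw)))
    (λ { refl refl → refl }))
  ≰1

-- A homomorphism injective on the vertices that lie on edges carries a cycle to a cycle of `F`.
-- Injectivity is asked only there because isolated vertices of the blow-up may share a label.
Forest⇒acyclic : ∀ {m n} {F : Graph m} → Forest F → (E : Fin n → Fin n → Bool) (f : Fin n → Fin m) →
  (∀ {u v} → T (E u v) → T (adj F (f u) (f v))) →
  (∀ {u v u′ v′} → T (E u u′) → T (E v v′) → f u ≡ f v → u ≡ v) →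
  ¬ Cycle E
Forest⇒acyclic {F = F} forest E f hom f-inj C = forest l (f ∘ at ∘ toℕ) c-inj (edge , closing)
  where
  open Cycle C
  open Path path

  -- Every vertex of the cycle lies on an edge, as `f-inj` requires; for the last one this is the
  -- closing edge.
  next : (i : Fin (suc (suc (suc l)))) → ∃ λ w → T (E (at (toℕ i)) w)
  next i with m≤n⇒m<n∨m≡n (≤-pred (Fin.toℕ<n i))
  ... | inj₁ i<    = _ , step i<
  ... | inj₂ i≡    = _ , subst (λ j → T (E (at j) (at 0))) (≡-sym i≡) close

  c-inj : Injective _≡_ _≡_ (f ∘ at ∘ toℕ)
  c-inj {i} {j} eq = toℕ-injective (at-inj (≤-pred (Fin.toℕ<n i)) (≤-pred (Fin.toℕ<n j))
    (f-inj (proj₂ (next i)) (proj₂ (next j)) eq))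

  edge : ∀ i → T (adj F (f (at (toℕ (inject₁ i)))) (f (at (suc (toℕ i)))))
  edge i = subst (λ j → T (adj F (f (at j)) (f (at (suc (toℕ i)))))) (≡-sym (Fin.toℕ-inject₁ i))
             (hom (step (Fin.toℕ<n i)))

  closing : T (adj F (f (at (toℕ (fromℕ (suc (suc l)))))) (f (at 0)))
  closing = subst (λ j → T (adj F (f (at j)) (f (at 0)))) (≡-sym (Fin.toℕ-fromℕ (suc (suc l)))) (hom close)

-- Degenerate blow-ups of a forest.

-- Each active vertex acts as a copy of its label; inactive ones are isolated and only pad the graph
-- to the required order.
blowUp : ∀ {m n} → Graph m → (Fin n → Fin m) → (Fin n → Bool) → Graph n
blowUp F label active = record
  { adj    = λ u v → (active u ∧ active v) ∧ adj F (label u) (label v)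
  ; sym    = λ u v → cong₂ _∧_ (∧-comm (active u) (active v)) (sym F (label u) (label v))
  ; irrefl = λ v → trans (cong (_ ∧_) (irrefl F (label v))) (∧-zeroʳ _)
  }

T-blowUp : ∀ {m n} (F : Graph m) (label : Fin n → Fin m) active {u v} →
  T (adj (blowUp F label active) u v) → (T (active u) × T (active v)) × T (adj F (label u) (label v))
T-blowUp F label active {u} {v} t = let a , e = to (T-∧ {active u ∧ active v}) t in to (T-∧ {active u}) a , e

blowUp-subgraph-edge : ∀ {m n} (F : Graph m) (label : Fin n → Fin m) active S (E : Fin n → Fin n → Bool) →
  (∀ u v → T (E u v) → T (induced (blowUp F label active) S u v)) →
  ∀ {u v} → T (E u v) → (T (active u) × T (active v)) × T (adj F (label u) (label v))
blowUp-subgraph-edge F label active S E E⊆ {u} {v} e =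
  T-blowUp F label active (proj₁ (to (T-induced (blowUp F label active) S {u} {v}) (E⊆ u v e)))

-- If the subgraph has a vertex labelled in `X`, its neighbours are labelled outside `X` by
-- stability, where labels are injective, so its degree is at most that of its label in `F`, hence
-- at most `k`. Otherwise labels are injective on all vertices with edges; without a vertex of
-- degree at most 1 there would be a cycle, and so one in `F`.
blowUp-Degenerate : ∀ {m n k} {F : Graph m} {X} {label : Fin n → Fin m} {active} →
  1 ≤ k → Forest F → LowStable F k X →
  (∀ {u v} → T (active u) → T (active v) → ¬ T (lookup X (label u)) → label u ≡ label v → u ≡ v) →
  Degenerate k (blowUp F label active)
blowUp-Degenerate {m} {n} {k} {F} {X} {label} {active} 1≤k forest ls label-inj S E E-sym E⊆ x
  with any? (λ v → T? (S v) ×-dec T? (lookup X (label v)))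
... | yes (v , Sv , Xv) = v , Sv , ≤-trans
  (countF-inj {p = E v} {adj F (label v)} (λ w y → T (E v w) × label w ≡ y)
    (λ {w} e → label w , proj₂ (edge e) , e , refl)
    (λ { {w} {w′} (e , refl) (e′ , eq) →
      label-inj (proj₂ (proj₁ (edge e))) (proj₂ (proj₁ (edge e′)))
        (λ Xw → stable Xv Xw (proj₂ (edge e))) (≡-sym eq) }))
  (low Xv)
  where
  open LowStable ls
  edge : ∀ {u w} → T (E u w) → (T (active u) × T (active w)) × T (adj F (label u) (label w))
  edge = blowUp-subgraph-edge F label active S E E⊆
... | no noX with any? (λ v → T? (S v) ×-dec (countF (E v) ≤? 1))
...   | yes (v , Sv , ≤1) = v , Sv , ≤-trans ≤1 1≤k
...   | no noLeaf = contradiction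
  (branching⇒Cycle {S = S} {E} E-sym (λ {v} e → adj-irrefl F (proj₂ (edge e))) (λ e → proj₁ (ends e))
    (λ {v} Sv → countF≰1⇒other {p = E v} (λ ≤1 → noLeaf (v , Sv , ≤1))) x)
  (Forest⇒acyclic {F = F} forest E label (λ e → proj₂ (edge e))
    (λ {u} {v} e e′ → label-inj (proj₁ (proj₁ (edge e))) (proj₁ (proj₁ (edge e′)))
      (λ Xu → noX (u , proj₁ (ends e) , Xu))))
  where
  ends : ∀ {u w} → T (E u w) → T (S u) × T (S w)
  ends {u} {w} e = proj₂ (to (T-induced (blowUp F label active) S {u} {w}) (E⊆ u w e))
  edge : ∀ {u w} → T (E u w) → (T (active u) × T (active w)) × T (adj F (label u) (label w))
  edge = blowUp-subgraph-edge F label active S E E⊆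

-- Producing copies from induced embeddings.

-- Non-edges are preserved too, so the copy can be taken to be the subgraph of `G` induced on the
-- image.
record InducedEmbedding {m n} (F : Graph m) (G : Graph n) (σ : Vec (Fin n) m) : Set where
  field
    injective : ∀ {i j} → lookup σ i ≡ lookup σ j → i ≡ j
    edges     : ∀ i j → adj G (lookup σ i) (lookup σ j) ≡ adj F i j

isImage : ∀ {m n} → Vec (Fin n) m → Fin n → Bool
isImage {m} σ v = anyV m λ i → lookup σ i ≟ᶠ v

T-isImage : ∀ {m n} (σ : Vec (Fin n) m) {v} → T (isImage σ v) ⇔ (∃ λ i → lookup σ i ≡ v)
T-isImage {m} σ = mk⇔ (λ t → let i , e = to (T-anyV {m}) t in i , to T-≟ᶠ e)
                    (λ { (i , e) → from (T-anyV {m}) (i , from T-≟ᶠ e) })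

imageVertices : ∀ {m n} → Vec (Fin n) m → Vec Bool n
imageVertices σ = Vec.tabulate (isImage σ)

imageEdges : ∀ {m n} → Graph n → Vec (Fin n) m → Vec (Vec Bool n) n
imageEdges G σ = Vec.tabulate λ u → Vec.tabulate (induced G (isImage σ) u)

InducedEmbedding⇒IsCopyVia : ∀ {m n} {F : Graph m} {G : Graph n} {σ} → InducedEmbedding F G σ →
  IsCopyVia F G (imageVertices σ) (imageEdges G σ) σ
InducedEmbedding⇒IsCopyVia {F = F} {G} {σ} emb = record
  { E-sym     = λ u v → trans (lookup-E u v) (trans (induced-sym G (isImage σ) u v) (≡-sym (lookup-E v u)))
  ; E⊆G       = λ {u} {v} e →
      let a , Su , Sv = to (T-induced G (isImage σ)) (subst T (lookup-E u v) e)
      in a , subst T (≡-sym (lookup-S u)) Su , subst T (≡-sym (lookup-S v)) Sv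
  ; injective = injective
  ; image     = λ {v} → mk⇔ (to (T-isImage σ) ∘ subst T (lookup-S v))
                          (subst T (≡-sym (lookup-S v)) ∘ from (T-isImage σ))
  ; edges     = λ i j → trans (lookup-E (lookup σ i) (lookup σ j)) (trans
      (T-ext (λ t → proj₁ (to (T-induced G (isImage σ)) t))
             (λ a → from (T-induced G (isImage σ)) (a , from (T-isImage σ) (i , refl) , from (T-isImage σ) (j , refl))))
      (edges i j))
  }
  where
  open InducedEmbedding emb
  lookup-S : ∀ v → lookup (imageVertices σ) v ≡ isImage σ v
  lookup-S = Vec.lookup∘tabulate (isImage σ)
  lookup-E : ∀ u v → lookup (lookup (imageEdges G σ) u) v ≡ induced G (isImage σ) u v
  lookup-E u v = trans (cong (λ row → lookup row v) (Vec.lookup∘tabulate _ u)) (Vec.lookup∘tabulate _ v)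

-- The vertex set of the copy built from `a` is the image of `σ a`, so copies from different
-- elements already differ in their vertex sets.
copies-≥ : ∀ {A : Set} {m n} (F : Graph m) (G : Graph n) {xs : List A} → Unique xs → (σ : A → Vec (Fin n) m) →
  (∀ {a} → a ∈ xs → InducedEmbedding F G (σ a)) →
  (∀ {a b} → (∀ x → ∃ λ y → lookup (σ b) y ≡ lookup (σ a) x) → a ≡ b) →
  length xs ≤ copies F G
copies-≥ {A} {m} {n} F G {xs} unique σ emb image-inj = ≤-trans
  (length-≤-via {ys = filter (T? ∘ isCopy F G) (subgraphs n)} R unique
    (λ {a} a∈ → let c = InducedEmbedding⇒IsCopyVia (emb a∈) in
      (imageVertices (σ a) , imageEdges G (σ a)) ,
      ∈-filter⁺ (T? ∘ isCopy F G) (∈-subgraphs _ _)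
        (isCopy-complete {S = imageVertices (σ a)} {imageEdges G (σ a)} c) , (λ {v} → IsCopyVia.image c))
    (λ {a} {b} r r′ → image-inj (λ x → to r′ (from r (x , refl)))))
  (≤-reflexive (≡-sym (copies≡length F G)))
  where
  R : A → Vec Bool n × Vec (Vec Bool n) n → Set
  R a (S , E) = ∀ {v} → T (lookup S v) ⇔ (∃ λ i → lookup (σ a) i ≡ v)

-- Lower bound: the extremal graph and its copies.

-- The first `r` vertices are padding; the others form `suc t` blocks, each with one place for every
-- vertex of `F`. Since `F` is nonempty, `fzero` can serve as the label of the padding.
module LowerBound {m k} (F : Graph (suc m)) (forest : Forest F) (1≤k : 1 ≤ k)
                  {X} (ls : LowStable F k X) (r t : ℕ) where

  Vertex : Set
  Vertex = Fin (r + suc t * suc m)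

  place : Fin (suc t) → Fin (suc m) → Vertex
  place i x = r Fin.↑ʳ Fin.combine i x

  coordinates : Vertex → Maybe (Fin (suc t) × Fin (suc m))
  coordinates v with Fin.splitAt r v
  ... | inj₁ _ = nothing
  ... | inj₂ w = just (Fin.remQuot (suc m) w)

  coordinates-place : ∀ i x → coordinates (place i x) ≡ just (i , x)
  coordinates-place i x rewrite Fin.splitAt-↑ʳ r (suc t * suc m) (Fin.combine i x) =
    cong just (Fin.remQuot-combine i x)

  coordinates-injective : ∀ {u v ix} → coordinates u ≡ just ix → coordinates v ≡ just ix → u ≡ v
  coordinates-injective e e′ = trans (place-coordinates e) (≡-sym (place-coordinates e′))
    where
    place-coordinates : ∀ {u ix} → coordinates u ≡ just ix → u ≡ place (proj₁ ix) (proj₂ ix)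
    place-coordinates {u} e with Fin.splitAt r u in eq
    place-coordinates {u} refl | inj₂ w = trans (≡-sym (Fin.splitAt⁻¹-↑ʳ eq))
      (cong (r Fin.↑ʳ_) (≡-sym (Fin.combine-remQuot {suc t} (suc m) w)))

  -- Copy 0 of every vertex of F is kept, the other copies only for vertices of X.
  kept : Fin (suc t) → Fin (suc m) → Bool
  kept fzero    x = true
  kept (fsuc _) x = lookup X x

  label : Vertex → Fin (suc m)
  label v = maybe proj₂ fzero (coordinates v)

  active : Vertex → Bool
  active v = maybe (λ (i , x) → kept i x) false (coordinates v)

  G : Graph (r + suc t * suc m)
  G = blowUp F label active

  label-place : ∀ i x → label (place i x) ≡ x
  label-place i x = cong (maybe proj₂ fzero) (coordinates-place i x)

  active-place : ∀ i x → active (place i x) ≡ kept i x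
  active-place i x = cong (maybe (λ (i , x) → kept i x) false) (coordinates-place i x)

  -- An active vertex labelled outside `X` can only be copy 0 of its label.
  label-inj : ∀ {u v} → T (active u) → T (active v) → ¬ T (lookup X (label u)) → label u ≡ label v → u ≡ v
  label-inj {u} {v} au av ¬Xu eq with coordinates u in cu | coordinates v in cv
  label-inj au av ¬Xu refl | just (fzero , x)  | just (fzero , .x)  = coordinates-injective cu cv
  label-inj au av ¬Xu refl | just (fsuc _ , x) | just (_ , .x)      = contradiction au ¬Xu
  label-inj au av ¬Xu refl | just (fzero , x)  | just (fsuc _ , .x) = contradiction av ¬Xu

  G-Degenerate : Degenerate k G
  G-Degenerate = blowUp-Degenerate {X = X} {label} {active} 1≤k forest ls label-inj

  choicesAt : Bool → List (Fin (suc t))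
  choicesAt true  = allFin (suc t)
  choicesAt false = fzero ∷ []

  choicesAt-Unique : ∀ b → Unique (choicesAt b)
  choicesAt-Unique true  = Unique.allFin⁺ (suc t)
  choicesAt-Unique false = [] ∷ []

  length-choicesAt : ∀ b → (if b then suc t else 1) ≤ length (choicesAt b)
  length-choicesAt true  = ≤-reflexive (≡-sym (length-tabulate {n = suc t} id))
  length-choicesAt false = ≤-refl

  choices : List (Vec (Fin (suc t)) (suc m))
  choices = products (suc m) (choicesAt ∘ lookup X)

  choicesAt-kept : ∀ {i x} → i ∈ choicesAt (lookup X x) → T (kept i x)
  choicesAt-kept {fzero}      _ = tt
  choicesAt-kept {fsuc i} {x} i∈ with lookup X x
  ... | true  = tt
  ... | false with i∈
  ...   | here ()
  ...   | there ()

  embed : Vec (Fin (suc t)) (suc m) → Vec Vertex (suc m)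
  embed τ = Vec.tabulate λ x → place (lookup τ x) x

  lookup-embed : ∀ τ x → lookup (embed τ) x ≡ place (lookup τ x) x
  lookup-embed τ = Vec.lookup∘tabulate _

  label-embed : ∀ τ x → label (lookup (embed τ) x) ≡ x
  label-embed τ x = trans (cong label (lookup-embed τ x)) (label-place (lookup τ x) x)

  embed-InducedEmbedding : ∀ {τ} → τ ∈ choices → InducedEmbedding F G (embed τ)
  embed-InducedEmbedding {τ} τ∈ = record
    { injective = λ {x} {y} eq → trans (≡-sym (label-embed τ x)) (trans (cong label eq) (label-embed τ y))
    ; edges     = λ x y → cong₂ _∧_ (cong₂ _∧_ (active-embed x) (active-embed y))
                                    (cong₂ (adj F) (label-embed τ x) (label-embed τ y))
    }
    where
    active-embed : ∀ x → active (lookup (embed τ) x) ≡ true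
    active-embed x = trans (cong active (lookup-embed τ x)) (trans (active-place (lookup τ x) x)
      (to T-≡ (choicesAt-kept {lookup τ x} {x} (∈-products⁻ {xss = choicesAt ∘ lookup X} τ∈ x))))

  -- Labels show which vertex of `F` each vertex of an image stands for, so even containment of the
  -- images matches them coordinate by coordinate, and the block number recovers `τ`.
  embed-image-injective : ∀ {τ τ′} → (∀ x → ∃ λ y → lookup (embed τ′) y ≡ lookup (embed τ) x) → τ ≡ τ′
  embed-image-injective {τ} {τ′} sub = lookup-ext agree
    where
    agree : ∀ x → lookup τ x ≡ lookup τ′ x
    agree x with sub x
    ... | y , eq with trans (≡-sym (label-embed τ′ y)) (trans (cong label eq) (label-embed τ x))
    ...   | refl = cong proj₁ (just-injective (trans (≡-sym (coordinates-place (lookup τ x) x))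
              (trans (cong coordinates (trans (≡-sym (lookup-embed τ x)) (trans (≡-sym eq) (lookup-embed τ′ x))))
                (coordinates-place (lookup τ′ x) x))))

  -- Every vertex of `X` chooses one of its `suc t` copies independently; all other vertices of `F`
  -- use copy 0.
  ^size≤copies : suc t ^ size X ≤ copies F G
  ^size≤copies = begin
    suc t ^ size X    ≤⟨ length-products-≥ (suc m) {choicesAt ∘ lookup X} (lookup X) (suc t)
                           (length-choicesAt ∘ lookup X) ⟩
    length choices    ≤⟨ copies-≥ F G (products-Unique (suc m) {choicesAt ∘ lookup X} (choicesAt-Unique ∘ lookup X))
                           embed
                           embed-InducedEmbedding embed-image-injective ⟩
    copies F G        ∎
    where open ≤-Reasoning

-- Graphs of every large order, and the two bounds together.

edgeless : ∀ n → Graph n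
edgeless n = record { adj = λ _ _ → false ; sym = λ _ _ → refl ; irrefl = λ _ → refl }

edgeless-Degenerate : ∀ {n k} → Degenerate k (edgeless n)
edgeless-Degenerate S E _ E⊆ (v , Sv) = v , Sv , ≤-trans
  (countF-≤ {p = E v} {ys = List.[] {A = ℕ}} (λ _ _ → ⊥) (λ {w} e → ⊥-elim (E⊆ v w e)) (λ ())) z≤n

^-distribʳ-* : ∀ a b n → (a * b) ^ n ≡ a ^ n * b ^ n
^-distribʳ-* a b zero    = refl
^-distribʳ-* a b (suc n) = trans (cong (a * b *_) (^-distribʳ-* a b n)) ([m*n]*[o*p]≡[m*o]*[n*p] a b (a ^ n) (b ^ n))

-- For nonempty `F`, division of `n` by `m` leaves a remainder below `m` and a positive quotient
-- `t`, so `n` is at most `2 * m * t`. Raising this to the power `alpha F k` produces the constant.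
lower-bound : ∀ {m k} (F : Graph m) → 1 ≤ k → Forest F → ∀ n → m ≤ n →
  ∃ λ (G : Graph n) → Degenerate k G × n ^ alpha F k ≤ (2 * m) ^ alpha F k * copies F G
-- On no vertices the exponent is 0, and the empty subgraph is the one copy needed.
lower-bound {zero} F _ _ n _ = edgeless n , edgeless-Degenerate ,
  ≤-trans (copies-≥ F (edgeless n) {xs = tt ∷ []} ([] ∷ []) (λ _ → []ᵥ)
             (λ _ → record { injective = λ { {()} } ; edges = λ () }) (λ _ → refl))
          (≤-reflexive (≡-sym (*-identityˡ _)))
lower-bound {suc m} {k} F 1≤k forest n m<n = go (n % suc m) (n / suc m) (m%n<n n (suc m))
  (m≥n⇒m/n>0 m<n) (m≡m%n+[m/n]*n n (suc m))
  where
  go : ∀ r t → r < suc m → 0 < t → n ≡ r + t * suc m →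
    ∃ λ (G : Graph n) → Degenerate k G × n ^ alpha F k ≤ (2 * suc m) ^ alpha F k * copies F G
  go r (suc t) r<m _ refl = G , G-Degenerate , (begin
    (r + suc t * suc m) ^ α               ≤⟨ ^-monoˡ-≤ α n≤ ⟩
    (2 * suc m * suc t) ^ α               ≡⟨ ^-distribʳ-* (2 * suc m) (suc t) α ⟩
    (2 * suc m) ^ α * suc t ^ α           ≤⟨ *-monoʳ-≤ ((2 * suc m) ^ α)
                                               (≤-trans (^-monoʳ-≤ (suc t) α≤size) ^size≤copies) ⟩
    (2 * suc m) ^ α * copies F G          ∎)
    where
    α≤size = proj₂ (proj₂ (alpha-attained F k))
    open LowerBound F forest 1≤k (proj₁ (proj₂ (alpha-attained F k))) r t
    open ≤-Reasoning
    α = alpha F k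
    n≤ : r + suc t * suc m ≤ 2 * suc m * suc t
    n≤ = begin
      r + suc t * suc m                     ≤⟨ +-monoˡ-≤ (suc t * suc m) (≤-trans (<⇒≤ r<m) (m≤n*m (suc m) (suc t))) ⟩
      suc t * suc m + suc t * suc m         ≡⟨ cong₂ _+_ (*-comm (suc t) (suc m))
                                                 (trans (*-comm (suc t) (suc m)) (≡-sym (+-identityʳ _))) ⟩
      2 * (suc m * suc t)                   ≡⟨ *-assoc 2 (suc m) (suc t) ⟨
      2 * suc m * suc t                     ∎

theorem1 : (k : ℕ) → 1 ≤ k → ∀ {m} (F : Graph m) → Forest F →
    ∃ λ c₁ → ∃ λ c₂ → ∃ λ N → ∀ (n : ℕ) → N ≤ n →
    ((G : Graph n) → Degenerate k G → copies F G ≤ c₂ * n ^ alpha F k)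
    × (∃ λ (G : Graph n) → Degenerate k G × n ^ alpha F k ≤ c₁ * copies F G)
theorem1 k 1≤k {m} F forest =
  -- The threshold `suc m` supplies both `1 ≤ n` for the upper bound and `m ≤ n` for the lower
  -- bound.
  (2 * m) ^ alpha F k , length (vecs bools m) * suc (m * k) ^ m , suc m , λ n m<n →
    (λ G → copies-≤ F G (≤-trans (s≤s z≤n) m<n)) , lower-bound F 1≤k forest n (<⇒≤ m<n)
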